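{- Let $lc_n$ be the number of linked cycles on $[n]$. Then $lc_1=1$, $lc_2=2$, and for all $n\ge3$, $$lc_n=(2n-3)lc_{n-1}+lc_{n-2}.$$
   Context: Two finite sets of integers $E,F$ are nearly disjoint if for every $i\in E\cap F$ either ($i=\min(E)$, $|E|>1$, $i\ne\min(F)$) or ($i=\min(F)$, $|F|>1$, $i\ne\min(E)$). A linked partition of $[n]$ is a set of nonempty subsets (blocks) of $[n]$ with union $[n]$, any two distinct blocks nearly disjoint. A linked cycle on $[n]$ is a linked partition of $[n]$ together with a cyclic arrangement of the elements of each block. -}

module Defs where

open import Data.Bool using (Bool; T)
open import Data.Bool.Properties using (T-irrelevant)
open import Data.Fin using (Fin; _≤_)
open import Data.Fin.Permutation using (↔⇒≡)
open import Data.Fin.Subset using (Subset; _∈_; _∩_; Nonempty; ∣_∣)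
open import Data.List using (List; _∷_; _∷ʳ_)
import Data.List.Membership.Propositional as List
open import Data.List.Relation.Unary.Unique.Propositional using (Unique)
open import Data.Nat using (ℕ; _<_)
open import Data.Product using (∃; _×_)
open import Data.Sum using (_⊎_)
open import Function.Bundles using (_⇔_; Inverse)
import Function.Construct.Composition as Compose
import Function.Construct.Symmetry as Symmetry
open import Level using (0ℓ)
open import Relation.Binary using (Rel; Setoid)
open import Relation.Binary.Construct.Closure.Equivalence using (EqClosure; reflexive; symmetric; transitive)
open import Relation.Binary.PropositionalEquality as ≡ using (_≡_; _≢_; refl; sym; trans; subst)
open import Relation.Nullary using (¬_)

-- The ground set [n] = {1, …, n} is represented by Fin n with its usual
-- order; only the order of the elements matters below.

IsMin : ∀ {n} → Fin n → Subset n → Set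
IsMin i E = i ∈ E × (∀ j → j ∈ E → i ≤ j)

NearlyDisjoint : ∀ {n} → Subset n → Subset n → Set
NearlyDisjoint E F = ∀ i → i ∈ E ∩ F →
    (IsMin i E × 1 < ∣ E ∣ × ¬ IsMin i F)
  ⊎ (IsMin i F × 1 < ∣ F ∣ × ¬ IsMin i E)

-- A set of subsets of [n] is given by its characteristic function, so two
-- linked partitions are the same when these functions agree pointwise.
record LinkedPartition (n : ℕ) : Set where
  field
    isBlock : Subset n → Bool

  IsBlock : Subset n → Set
  IsBlock B = T (isBlock B)

  field
    nonempty       : ∀ B → IsBlock B → Nonempty B
    covers         : ∀ i → ∃ λ B → IsBlock B × i ∈ B
    nearlyDisjoint : ∀ E F → IsBlock E → IsBlock F → E ≢ F → NearlyDisjoint E F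

-- A cyclic arrangement of B is a duplicate-free listing of the elements of B,
-- taken up to rotation (the relation _≈ᶜ_).
record CyclicArrangement {n : ℕ} (B : Subset n) : Set where
  field
    listing : List (Fin n)
    unique  : Unique listing
    lists   : ∀ i → (i List.∈ listing) ⇔ (i ∈ B)

open CyclicArrangement public

data _↻_ {A : Set} : Rel (List A) 0ℓ where
  rotate : ∀ x xs → (x ∷ xs) ↻ (xs ∷ʳ x)

_≈ᶜ_ : ∀ {n} {B : Subset n} → Rel (CyclicArrangement B) 0ℓ
c ≈ᶜ d = EqClosure _↻_ (listing c) (listing d)

record LinkedCycle (n : ℕ) : Set where
  field
    partition : LinkedPartition n

  open LinkedPartition partition public

  field
    arrangement : ∀ B → IsBlock B → CyclicArrangement B

record _≈_ {n : ℕ} (P Q : LinkedCycle n) : Set where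
  private
    module P = LinkedCycle P
    module Q = LinkedCycle Q
  field
    sameBlocks       : ∀ B → P.isBlock B ≡ Q.isBlock B
    sameArrangements : ∀ B (p : P.IsBlock B) (q : Q.IsBlock B) →
                       P.arrangement B p ≈ᶜ Q.arrangement B q

open _≈_ public

LinkedCycles : ℕ → Setoid 0ℓ 0ℓ
LinkedCycles n = record
  { Carrier = LinkedCycle n
  ; _≈_ = _≈_
  ; isEquivalence = record
    { refl = λ {P} → record
      { sameBlocks = λ B → refl
      ; sameArrangements = λ B p q →
          subst (λ r → LinkedCycle.arrangement P B p ≈ᶜ LinkedCycle.arrangement P B r)
                (T-irrelevant p q) (reflexive _↻_)
      }
    ; sym = λ e → record
      { sameBlocks = λ B → sym (sameBlocks e B)
      ; sameArrangements = λ B p q → symmetric _↻_ (sameArrangements e B q p)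
      }
    ; trans = λ e f → record
      { sameBlocks = λ B → trans (sameBlocks e B) (sameBlocks f B)
      ; sameArrangements = λ B p r →
          let q = subst T (sameBlocks e B) p
          in transitive _↻_ (sameArrangements e B p q) (sameArrangements f B q r)
      }
    }
  }

HasCardinality : Setoid 0ℓ 0ℓ → ℕ → Set
HasCardinality S k = Inverse S (≡.setoid (Fin k))

-- A setoid has at most one cardinality, so a function lc with
-- HasCardinality (LinkedCycles n) (lc n) for all n is determined pointwise.
cardinality-unique : ∀ {S j k} → HasCardinality S j → HasCardinality S k → j ≡ k
cardinality-unique f g = ↔⇒≡ (Compose.inverse (Symmetry.inverse f) g)

{-# OPTIONS --safe #-}
module Submission where

-- Two blocks of a linked partition share at most one element, which is then the
-- minimum of exactly one of them.  So making every element that is not the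
-- minimum of some block B containing it a child of min B gives an increasing
-- forest, and cutting the cycle on B at min B orders the children of min B.
-- Linked cycles are thus the increasing forests on [n] whose vertices have
-- linearly ordered children.  The largest vertex n is a leaf: it is a new root,
-- or it is put in one of the (n − 1) + s places of a forest on [n − 1] with s
-- edges.  Hence the number c(n, s) of forests with s edges satisfies
--   c(n + 1, s + 1) = c(n, s + 1) + (n + s) c(n, s),
-- from which (n − s) c(n + 1, s) = (n + s) c(n, s) follows by induction; summing
-- over s gives the recurrence for the totals.

open import Defs
import Algebra.Properties.CommutativeMonoid.Sum as Sum
open import Data.Bool using (T)
import Data.Bool.Properties as Bool
open import Data.Empty using (⊥)
open import Data.Fin as Fin using (Fin; zero; suc)
open import Data.Fin.Properties as Fin
  using (+↔⊎; *↔×; any?; all?; opposite-involutive; suc-injective; ≤∧≢⇒<)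
open import Data.Fin.Subset as Subset using (Subset; ⁅_⁆; _∪_; ∣_∣; Nonempty; inside; outside)
open import Data.Fin.Subset.Properties as Subset
  using ( anySubset?; x∈p∩q⁺; x∈p∩q⁻; x∈p∪q⁺; x∈p∪q⁻; x∈⁅x⁆; x∈⁅y⁆⇒x≡y; ∉⊥; ⊆-antisym
        ; p⊂q⇒∣p∣<∣q∣; ∣⁅x⁆∣≡1; ∪-identityʳ)
open import Data.List using (List; []; _∷_; [_]; _++_; _∷ʳ_; map; length; initLast; _∷ʳ′_)
import Data.List.Membership.DecPropositional as DecMembership
open import Data.List.Membership.Propositional using (_∈_; _∉_)
open import Data.List.Membership.Propositional.Properties using (∈-map⁻; ∈-∃++; ∈-++⁺ʳ)
open import Data.List.Properties as List
  using (++-assoc; ++-identityʳ; length-map; map-injective; ∷-injectiveʳ; ∷ʳ-injective)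
open import Data.List.Relation.Binary.Permutation.Propositional
  using (_↭_; ↭-refl; ↭-sym; ↭-trans; ↭⇒↭ₛ; prep; swap)
open import Data.List.Relation.Binary.Permutation.Propositional.Properties using (∈-resp-↭; ++-comm)
import Data.List.Relation.Binary.Permutation.Setoid.Properties as ↭ₛ
open import Data.List.Relation.Unary.All.Properties using (All¬⇒¬Any; ¬Any⇒All¬)
open import Data.List.Relation.Unary.AllPairs using ([]; _∷_)
open import Data.List.Relation.Unary.Any using (here; there)
open import Data.List.Relation.Unary.Unique.Propositional using (Unique)
open import Data.List.Relation.Unary.Unique.Propositional.Properties using (map⁺)
open import Data.Nat as ℕ using (ℕ; zero; suc; _+_; _*_; _∸_; _≤_)
import Data.Nat.Properties as ℕ
open import Data.Nat.Tactic.RingSolver using (solve-∀)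
open import Data.Product using (Σ; _×_; _,_; ∃; ∃₂; proj₁; proj₂)
open import Data.Product.Function.Dependent.Propositional using (Σ-↔)
open import Data.Product.Function.NonDependent.Propositional using (_×-↔_)
open import Data.Sum using (_⊎_; inj₁; inj₂; [_,_]′)
open import Data.Sum.Function.Propositional using (_⊎-↔_)
open import Data.Vec using (_∷_; here; there)
import Data.Vec.Properties as Vec
open import Function using (_∘_; _$_; const; id)
open import Function.Bundles using (_↔_; mk↔ₛ′; mk⇔; Inverse; Equivalence)
import Function.Construct.Composition as Compose
open import Function.Properties.Inverse using (↔-refl; ↔-sym; ↔-trans)
open import Level using (0ℓ)
open import Relation.Binary using (Rel; Setoid)
open import Relation.Binary.Construct.Closure.Equivalence using (EqClosure; symmetric; transitive)
open import Relation.Binary.Construct.Closure.ReflexiveTransitive using (ε; _◅_)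
open import Relation.Binary.Construct.Closure.Symmetric using (fwd; bwd)
open import Relation.Binary.PropositionalEquality hiding ([_])
open import Relation.Nullary
  using (Dec; yes; no; ¬_; ¬?; contradiction; _×-dec_; _⊎-dec_; _→-dec_)
open import Relation.Nullary.Decidable using (⌊_⌋; toWitness; fromWitness; decidable-stable)

open Sum ℕ.+-0-commutativeMonoid using (sum; sum-cong-≗)

-- Weighted totals and their recurrence

-- weighted n w is Σₛ c(n, s) w(s), computed by moving the recurrence for c onto w.
weighted : ℕ → (ℕ → ℕ) → ℕ
weighted zero    w = w 0
weighted (suc n) w = weighted n (λ s → w s + (n + s) * w (suc s))

weighted-cong : ∀ n {v w} → (∀ s → v s ≡ w s) → weighted n v ≡ weighted n w
weighted-cong zero    eq = eq 0
weighted-cong (suc n) eq =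
  weighted-cong n λ s → cong₂ _+_ (eq s) (cong ((n + s) *_) (eq (suc s)))

weighted-+ : ∀ n v w → weighted n (λ s → v s + w s) ≡ weighted n v + weighted n w
weighted-+ zero    v w = refl
weighted-+ (suc n) v w = trans
  (weighted-cong n λ s → interchange (v s) (w s) (n + s) (v (suc s)) (w (suc s)))
  (weighted-+ n _ _)
  where
  interchange : ∀ a b k c d → a + b + k * (c + d) ≡ a + k * c + (b + k * d)
  interchange = solve-∀

weighted-* : ∀ n k w → weighted n (λ s → k * w s) ≡ k * weighted n w
weighted-* zero    k w = refl
weighted-* (suc n) k w = trans
  (weighted-cong n λ s → factor k (w s) (n + s) (w (suc s)))
  (weighted-* n k _)
  where
  factor : ∀ k a m b → k * a + m * (k * b) ≡ k * (a + m * b)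
  factor = solve-∀

-- (n − s) c(n + 1, s) = (n + s) c(n, s) tested against w, with c(n + 1, s) expanded
-- by its recurrence and both sides moved so that no subtraction occurs.
weighted-balance : ∀ n w →
  weighted n (λ s → 2 * s * w s + (n + s) * suc s * w (suc s)) ≡
  weighted n (λ s → n * (n + s) * w (suc s))
weighted-balance zero    w = refl
weighted-balance (suc n) w = begin
  weighted (suc n) (λ s → 2 * s * w s + (suc n + s) * suc s * w (suc s))
    ≡⟨ weighted-cong n (λ s → regroupˡ n s (w s) (w (suc s)) (w (suc (suc s)))) ⟩
  weighted n (λ s → L w s + (L w′ s + rest s))
    ≡⟨ weighted-+ n _ _ ⟩
  weighted n (L w) + weighted n (λ s → L w′ s + rest s)
    ≡⟨ cong₂ _+_ (weighted-balance n w) (weighted-+ n _ _) ⟩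
  weighted n (R w) + (weighted n (L w′) + weighted n rest)
    ≡⟨ cong (λ x → weighted n (R w) + (x + weighted n rest)) (weighted-balance n w′) ⟩
  weighted n (R w) + (weighted n (R w′) + weighted n rest)
    ≡⟨ cong (weighted n (R w) +_) (weighted-+ n _ _) ⟨
  weighted n (R w) + weighted n (λ s → R w′ s + rest s)
    ≡⟨ weighted-+ n _ _ ⟨
  weighted n (λ s → R w s + (R w′ s + rest s))
    ≡⟨ weighted-cong n (λ s → regroupʳ n s (w (suc s)) (w (suc (suc s)))) ⟨
  weighted (suc n) (λ s → suc n * (suc n + s) * w (suc s)) ∎
  where
  open ≡-Reasoning
  L R : (ℕ → ℕ) → ℕ → ℕ
  L v s = 2 * s * v s + (n + s) * suc s * v (suc s)
  R v s = n * (n + s) * v (suc s)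
  -- The weight `w′` is chosen so that `L w′` absorbs `suc s` of the `suc (suc s)` copies of
  -- `(n + s) * (n + s + 2) * w (suc (suc s))`. The remaining copy goes into `rest`, which is the
  -- same on both sides.
  w′ rest : ℕ → ℕ
  w′ s = (n + s + 1) * w (suc s)
  rest s = (2 * n + s + 1) * w (suc s) + (n + s) * (n + s + 2) * w (suc (suc s))
  regroupˡ : ∀ n s a b c →
    2 * s * a + (suc n + s) * suc s * b + (n + s) * (2 * suc s * b + (suc n + suc s) * suc (suc s) * c) ≡
    2 * s * a + (n + s) * suc s * b + (2 * s * ((n + s + 1) * b) + (n + s) * suc s * ((n + suc s + 1) * c)
      + ((2 * n + s + 1) * b + (n + s) * (n + s + 2) * c))
  regroupˡ = solve-∀
  regroupʳ : ∀ n s b c →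
    suc n * (suc n + s) * b + (n + s) * (suc n * (suc n + suc s) * c) ≡
    n * (n + s) * b + (n * (n + s) * ((n + suc s + 1) * c)
      + ((2 * n + s + 1) * b + (n + s) * (n + s + 2) * c))
  regroupʳ = solve-∀

count : ℕ → ℕ
count n = weighted n (const 1)

-- Two unfoldings turn `count (2 + m)` into a total at `m` of a weight quadratic in `s`.
-- `weighted-balance` trades the part containing the square of `s` for one linear in `s`, and what
-- results is a multiple of the weight of `count (1 + m)` plus the weight of `count m`.
count-recurrence : ∀ m → count (2 + m) ≡ (2 * m + 1) * count (1 + m) + count m
count-recurrence m = begin
  count (2 + m)
    ≡⟨ weighted-cong m (λ s → regroupˡ m s) ⟩
  weighted m (λ s → 2 * s * 1 + (m + s) * suc s * 1 + rest s)
    ≡⟨ weighted-+ m _ _ ⟩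
  weighted m (λ s → 2 * s * 1 + (m + s) * suc s * 1) + weighted m rest
    ≡⟨ cong (_+ weighted m rest) (weighted-balance m (const 1)) ⟩
  weighted m (λ s → m * (m + s) * 1) + weighted m rest
    ≡⟨ weighted-+ m _ _ ⟨
  weighted m (λ s → m * (m + s) * 1 + rest s)
    ≡⟨ weighted-cong m (λ s → regroupʳ m s) ⟩
  weighted m (λ s → (2 * m + 1) * (1 + (m + s) * 1) + 1)
    ≡⟨ weighted-+ m _ _ ⟩
  weighted m (λ s → (2 * m + 1) * (1 + (m + s) * 1)) + count m
    ≡⟨ cong (_+ count m) (weighted-* m (2 * m + 1) _) ⟩
  (2 * m + 1) * count (1 + m) + count m ∎
  where
  open ≡-Reasoning
  rest : ℕ → ℕ
  rest s = m * m + 3 * m + m * s + s + 2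
  regroupˡ : ∀ m s →
    (1 + (suc m + s) * 1) + (m + s) * (1 + (suc m + suc s) * 1) ≡
    2 * s * 1 + (m + s) * suc s * 1 + (m * m + 3 * m + m * s + s + 2)
  regroupˡ = solve-∀
  regroupʳ : ∀ m s →
    m * (m + s) * 1 + (m * m + 3 * m + m * s + s + 2) ≡
    (2 * m + 1) * (1 + (m + s) * 1) + 1
  regroupʳ = solve-∀

-- Increasing forests as codes

-- Labels are reversed here: zero is the newest (largest) vertex, older ones are suc.
insertZero : ∀ {n} (xs : List (Fin n)) → Fin (suc (length xs)) → List (Fin (suc n))
insertZero xs       zero    = zero ∷ map suc xs
insertZero (x ∷ xs) (suc p) = suc x ∷ insertZero xs p

-- Codes and child lists are defined together because the number of places for a new child of `v`
-- depends on how many children `v` already has.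
data Code : ℕ → Set
children : ∀ {n} → Code n → Fin n → List (Fin n)

data Code where
  []    : Code 0
  root  : ∀ {n} → Code n → Code (suc n)
  child : ∀ {n} (c : Code n) (v : Fin n) →
          Fin (suc (length (children c v))) → Code (suc n)

children (root c)      zero    = []
children (root c)      (suc v) = map suc (children c v)
children (child c u p) zero    = []
children (child c u p) (suc v) with v Fin.≟ u
... | yes refl = insertZero (children c v) p
... | no _     = map suc (children c v)

edges : ∀ {n} → Code n → ℕ
edges []            = 0
edges (root c)      = edges c
edges (child c _ _) = suc (edges c)


-- Counting codes

length-insertZero : ∀ {n} (xs : List (Fin n)) p → length (insertZero xs p) ≡ suc (length xs)
length-insertZero xs       zero    = cong suc (length-map suc xs)
length-insertZero (_ ∷ xs) (suc p) = cong suc (length-insertZero xs p)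

insertZero-↭ : ∀ {n} (xs : List (Fin n)) p → insertZero xs p ↭ zero ∷ map suc xs
insertZero-↭ xs       zero    = ↭-refl
insertZero-↭ (x ∷ xs) (suc p) = ↭-trans (prep (suc x) (insertZero-↭ xs p))
  (swap (suc x) zero ↭-refl)

children-child-≡ : ∀ {n} (c : Code n) u p →
  children (child c u p) (suc u) ≡ insertZero (children c u) p
children-child-≡ c u p with u Fin.≟ u
... | yes refl = refl
... | no u≢u   = contradiction refl u≢u

children-child-≢ : ∀ {n} (c : Code n) {u v} p → v ≢ u →
  children (child c u p) (suc v) ≡ map suc (children c v)
children-child-≢ c {u} {v} p v≢u with v Fin.≟ u
... | yes v≡u = contradiction v≡u v≢u
... | no _    = refl

sum-bump : ∀ {n} (u : Fin n) {f g : Fin n → ℕ} →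
  f u ≡ suc (g u) → (∀ v → v ≢ u → f v ≡ g v) → sum f ≡ suc (sum g)
sum-bump zero    at off = cong₂ _+_ at (sum-cong-≗ λ v → off (suc v) λ ())
sum-bump (suc u) {g = g} at off = trans
  (cong₂ _+_ (off zero λ ()) (sum-bump u at λ v v≢u → off (suc v) (v≢u ∘ suc-injective)))
  (ℕ.+-suc (g zero) _)

-- A new vertex always brings one place of its own; if it is a child, the longer list at its parent
-- brings a second one, matching the new edge.
sum-slots : ∀ {n} (c : Code n) → sum (λ v → suc (length (children c v))) ≡ n + edges c
sum-slots []       = refl
sum-slots (root c) = cong suc $ trans
  (sum-cong-≗ λ v → cong suc (length-map suc (children c v)))
  (sum-slots c)
sum-slots {suc n} (child c u p) = cong suc $ trans
  (sum-bump u
    (cong suc (trans (cong length (children-child-≡ c u p)) (length-insertZero (children c u) p)))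
    (λ v v≢u → cong suc (trans (cong length (children-child-≢ c p v≢u))
      (length-map suc (children c v)))))
  (trans (cong suc (sum-slots c)) (sym (ℕ.+-suc n (edges c))))

Σ-Fin↔sum : ∀ {n} (f : Fin n → ℕ) → Σ (Fin n) (Fin ∘ f) ↔ Fin (sum f)
Σ-Fin↔sum {zero}  f = mk↔ₛ′ (λ ()) (λ ()) (λ ()) (λ ())
Σ-Fin↔sum {suc n} f =
  ↔-trans split (↔-trans (↔-refl ⊎-↔ Σ-Fin↔sum (f ∘ suc)) (↔-sym +↔⊎))
  where
  split : Σ (Fin (suc n)) (Fin ∘ f) ↔ (Fin (f zero) ⊎ Σ (Fin n) (Fin ∘ f ∘ suc))
  split = mk↔ₛ′
    (λ { (zero , k) → inj₁ k ; (suc i , k) → inj₂ (i , k) })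
    (λ { (inj₁ k) → zero , k ; (inj₂ (i , k)) → suc i , k })
    (λ { (inj₁ _) → refl ; (inj₂ _) → refl })
    (λ { (zero , _) → refl ; (suc _ , _) → refl })

Fin-cong : ∀ {m n} → m ≡ n → Fin m ↔ Fin n
Fin-cong refl = ↔-refl

Slot : ∀ {n} → Code n → Set
Slot {n} c = Σ (Fin n) λ v → Fin (suc (length (children c v)))

-- Attaching `w (edges c)` labels to each code makes the induction work: peeling off the newest
-- vertex of a code moves the weight exactly as the definition of `weighted` does.
weightedCodes↔Fin : ∀ n w → Σ (Code n) (λ c → Fin (w (edges c))) ↔ Fin (weighted n w)
weightedCodes↔Fin zero w = mk↔ₛ′ (λ { ([] , k) → k }) ([] ,_) (λ _ → refl) (λ { ([] , _) → refl })
weightedCodes↔Fin (suc n) w =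
  ↔-trans split (↔-trans (Σ-↔ ↔-refl λ {c} → fibre c) (weightedCodes↔Fin n _))
  where
  Fibre : Code n → Set
  Fibre c = Fin (w (edges c)) ⊎ (Slot c × Fin (w (suc (edges c))))
  split : Σ (Code (suc n)) (λ c → Fin (w (edges c))) ↔ Σ (Code n) Fibre
  split = mk↔ₛ′
    (λ { (root c , k) → c , inj₁ k ; (child c v p , k) → c , inj₂ ((v , p) , k) })
    (λ { (c , inj₁ k) → root c , k ; (c , inj₂ ((v , p) , k)) → child c v p , k })
    (λ { (_ , inj₁ _) → refl ; (_ , inj₂ _) → refl })
    (λ { (root _ , _) → refl ; (child _ _ _ , _) → refl })
  fibre : ∀ c → Fibre c ↔ Fin (w (edges c) + (n + edges c) * w (suc (edges c)))
  fibre c = ↔-trans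
    (↔-refl ⊎-↔ ↔-trans
      (↔-trans (Σ-Fin↔sum _) (Fin-cong (sum-slots c)) ×-↔ ↔-refl)
      (↔-sym *↔×))
    (↔-sym +↔⊎)

code↔Fin : ∀ n → Code n ↔ Fin (count n)
code↔Fin n = ↔-trans
  (mk↔ₛ′ (_, zero) proj₁ (λ { (_ , zero) → refl }) (λ _ → refl))
  (weightedCodes↔Fin n (const 1))

-- Codes and increasing forests

-- The order is a parameter since codes number vertices from the newest one and linked cycles from
-- the smallest.
record Forest {n : ℕ} (_≺_ : Rel (Fin n) 0ℓ) (G : Fin n → List (Fin n)) : Set where
  field
    ordered   : ∀ {v w} → w ∈ G v → v ≺ w
    distinct  : ∀ v → Unique (G v)
    oneParent : ∀ {u v w} → w ∈ G u → w ∈ G v → u ≡ v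

open Forest

-- `Z` marks the parents of the newest vertex: none after `root`, only `u` after `child c u p`.
data OffspringOf {n : ℕ} (Z : Fin n → Set) (G : Fin n → List (Fin n)) : Rel (Fin (suc n)) 0ℓ where
  new : ∀ {v} → Z v → OffspringOf Z G zero (suc v)
  old : ∀ {w v} → w ∈ G v → OffspringOf Z G (suc w) (suc v)

root-offspring : ∀ {n} (c : Code n) {y i} → y ∈ children (root c) i →
  OffspringOf (λ _ → ⊥) (children c) y i
root-offspring c {i = suc v} m with ∈-map⁻ suc m
... | _ , m′ , refl = old m′

child-offspring : ∀ {n} (c : Code n) {u p y i} → y ∈ children (child c u p) i →
  OffspringOf (_≡ u) (children c) y i
child-offspring c {u} {p} {i = suc v} m with v Fin.≟ u
child-offspring c {u} {p} {i = suc v} m | no _ with ∈-map⁻ suc m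
... | _ , m′ , refl = old m′
child-offspring c {u} {p} {i = suc v} m | yes refl with ∈-resp-↭ (insertZero-↭ (children c v) p) m
... | here refl = new refl
... | there m′ with ∈-map⁻ suc m′
... | _ , m″ , refl = old m″

Unique-resp-↭ : ∀ {A : Set} {xs ys : List A} → xs ↭ ys → Unique xs → Unique ys
Unique-resp-↭ p = ↭ₛ.Unique-resp-↭ (setoid _) (↭⇒↭ₛ p)

zero∉map-suc : ∀ {n} (xs : List (Fin n)) → Fin.zero ∉ map Fin.suc xs
zero∉map-suc xs m with ∈-map⁻ suc m
... | _ , _ , ()

insertZero-unique : ∀ {n} (xs : List (Fin n)) p → Unique xs → Unique (insertZero xs p)
insertZero-unique xs p !xs = Unique-resp-↭ (↭-sym (insertZero-↭ xs p))
  (¬Any⇒All¬ _ (zero∉map-suc xs) ∷ map⁺ suc-injective !xs)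

extend-forest : ∀ {n} {Z : Fin n → Set} {G : Fin n → List (Fin n)} {H} →
  Forest Fin._>_ G → (∀ {u v} → Z u → Z v → u ≡ v) →
  (∀ {y i} → y ∈ H i → OffspringOf Z G y i) → (∀ i → Unique (H i)) →
  Forest Fin._>_ H
extend-forest {Z = Z} {G} F Z! offspring H! = record
  { ordered   = ordered′ ∘ offspring
  ; distinct  = H!
  ; oneParent = λ p q → oneParent′ (offspring p) (offspring q)
  }
  where
  ordered′ : ∀ {y i} → OffspringOf Z G y i → i Fin.> y
  ordered′ (new _) = ℕ.s≤s ℕ.z≤n
  ordered′ (old m) = ℕ.s≤s (ordered F m)
  oneParent′ : ∀ {y i j} → OffspringOf Z G y i → OffspringOf Z G y j → i ≡ j
  oneParent′ (new p) (new q) = cong suc (Z! p q)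
  oneParent′ (old p) (old q) = cong suc (oneParent F p q)

children-forest : ∀ {n} (c : Code n) → Forest Fin._>_ (children c)
children-forest []       = record
  { ordered = λ { {()} } ; distinct = λ () ; oneParent = λ { {()} } }
children-forest (root c) = extend-forest (children-forest c) (λ ()) (root-offspring c) λ
  { zero    → []
  ; (suc v) → map⁺ suc-injective (distinct (children-forest c) v)
  }
children-forest (child c u p) =
  extend-forest (children-forest c) (λ v≡u w≡u → trans v≡u (sym w≡u))
    (child-offspring c {u} {p}) unique′
  where
  unique′ : ∀ i → Unique (children (child c u p) i)
  unique′ zero = []
  unique′ (suc v) with v Fin.≟ u
  ... | yes refl = insertZero-unique (children c v) p (distinct (children-forest c) v)
  ... | no _     = map⁺ suc-injective (distinct (children-forest c) v)

-- Removing the newest vertex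

dropZeros : ∀ {n} → List (Fin (suc n)) → List (Fin n)
dropZeros []           = []
dropZeros (zero  ∷ xs) = dropZeros xs
dropZeros (suc x ∷ xs) = x ∷ dropZeros xs

dropZeros-map-suc : ∀ {n} (xs : List (Fin n)) → dropZeros (map suc xs) ≡ xs
dropZeros-map-suc []       = refl
dropZeros-map-suc (x ∷ xs) = cong (x ∷_) (dropZeros-map-suc xs)

dropZeros-insertZero : ∀ {n} (xs : List (Fin n)) p → dropZeros (insertZero xs p) ≡ xs
dropZeros-insertZero xs       zero    = dropZeros-map-suc xs
dropZeros-insertZero (x ∷ xs) (suc p) = cong (x ∷_) (dropZeros-insertZero xs p)

map-suc-dropZeros : ∀ {n} (xs : List (Fin (suc n))) → zero ∉ xs → map suc (dropZeros xs) ≡ xs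
map-suc-dropZeros []           0∉xs = refl
map-suc-dropZeros (zero  ∷ xs) 0∉xs = contradiction (here refl) 0∉xs
map-suc-dropZeros (suc x ∷ xs) 0∉xs = cong (suc x ∷_) (map-suc-dropZeros xs (0∉xs ∘ there))

-- Without repetitions the first `zero` is the only one, so its position is all that is lost. The
-- list `ys` is free so that the position gets the type that `child` expects, with `ys` the child
-- list of a code.
insertZero-dropZeros : ∀ {n} (xs : List (Fin (suc n))) → zero ∈ xs → Unique xs →
  ∀ {ys} → dropZeros xs ≡ ys → ∃ λ p → insertZero ys p ≡ xs
insertZero-dropZeros (zero  ∷ xs) 0∈xs (0∉xs ∷ !xs) refl =
  zero , cong (zero ∷_) (map-suc-dropZeros xs (All¬⇒¬Any 0∉xs))
insertZero-dropZeros (suc x ∷ xs) (there 0∈xs) (_ ∷ !xs) refl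
  with p , eq ← insertZero-dropZeros xs 0∈xs !xs refl = suc p , cong (suc x ∷_) eq

∈-dropZeros⁻ : ∀ {n} (xs : List (Fin (suc n))) {x} → x ∈ dropZeros xs → suc x ∈ xs
∈-dropZeros⁻ (zero  ∷ xs) m           = there (∈-dropZeros⁻ xs m)
∈-dropZeros⁻ (suc x ∷ xs) (here refl) = here refl
∈-dropZeros⁻ (suc x ∷ xs) (there m)   = there (∈-dropZeros⁻ xs m)

dropZeros-unique : ∀ {n} (xs : List (Fin (suc n))) → Unique xs → Unique (dropZeros xs)
dropZeros-unique []           []           = []
dropZeros-unique (zero  ∷ xs) (_ ∷ !xs)    = dropZeros-unique xs !xs
dropZeros-unique (suc x ∷ xs) (x∉xs ∷ !xs) =
  ¬Any⇒All¬ _ (All¬⇒¬Any x∉xs ∘ ∈-dropZeros⁻ xs) ∷ dropZeros-unique xs !xs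

dropZeros-forest : ∀ {n} {G : Fin (suc n) → List (Fin (suc n))} →
  Forest Fin._>_ G → Forest Fin._>_ (λ v → dropZeros (G (suc v)))
dropZeros-forest F = record
  { ordered   = λ m → ℕ.s<s⁻¹ (ordered F (∈-dropZeros⁻ _ m))
  ; distinct  = λ v → dropZeros-unique _ (distinct F (suc v))
  ; oneParent = λ p q → suc-injective (oneParent F (∈-dropZeros⁻ _ p) (∈-dropZeros⁻ _ q))
  }

childless-zero : ∀ {n} {G : Fin (suc n) → List (Fin (suc n))} → Forest Fin._>_ G → G zero ≡ []
childless-zero {G = G} F with G zero | ordered F {zero}
... | []    | _     = refl
... | _ ∷ _ | below = contradiction (below (here refl)) λ ()

_∈?_ : ∀ {n} (x : Fin n) xs → Dec (x ∈ xs)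
_∈?_ = DecMembership._∈?_ Fin._≟_

-- Induction by deleting `zero`, which is childless by `ordered`. It is a root if no list contains
-- it; otherwise `oneParent` confines it to a single list, and its position there supplies the
-- place.
children-surjective : ∀ {n} {G : Fin n → List (Fin n)} → Forest Fin._>_ G →
  ∃ λ c → ∀ v → children c v ≡ G v
children-surjective {zero}      F = [] , λ ()
children-surjective {suc n} {G} F
  with c , eq ← children-surjective (dropZeros-forest F)
     | any? (λ v → zero ∈? G (suc v))
... | no 0∉G = root c , λ
  { zero    → sym (childless-zero F)
  ; (suc v) → trans (cong (map suc) (eq v)) (map-suc-dropZeros (G (suc v)) (0∉G ∘ (v ,_)))
  }
... | yes (u , 0∈Gu)
  with p , eqᵤ ← insertZero-dropZeros (G (suc u)) 0∈Gu (distinct F (suc u)) (sym (eq u)) =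
  child c u p , λ
  { zero    → sym (childless-zero F)
  ; (suc v) → atSuc v
  }
  where
  atSuc : ∀ v → children (child c u p) (suc v) ≡ G (suc v)
  atSuc v with v Fin.≟ u
  ... | yes refl = eqᵤ
  ... | no v≢u   = trans (cong (map suc) (eq v)) (map-suc-dropZeros (G (suc v))
    λ 0∈Gv → v≢u (suc-injective (oneParent F 0∈Gv 0∈Gu)))

dropZeros-child : ∀ {n} (c : Code n) u p v →
  dropZeros (children (child c u p) (suc v)) ≡ children c v
dropZeros-child c u p v with v Fin.≟ u
... | yes refl = dropZeros-insertZero (children c v) p
... | no _     = dropZeros-map-suc (children c v)

zero∈insertZero : ∀ {n} (xs : List (Fin n)) p → zero ∈ insertZero xs p
zero∈insertZero xs p = ∈-resp-↭ (↭-sym (insertZero-↭ xs p)) (here refl)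

zero∈child : ∀ {n} (c : Code n) u p → zero ∈ children (child c u p) (suc u)
zero∈child c u p = subst (zero ∈_) (sym (children-child-≡ c u p)) (zero∈insertZero (children c u) p)

insertZero-injective : ∀ {n} (xs : List (Fin n)) {p q} → insertZero xs p ≡ insertZero xs q → p ≡ q
insertZero-injective xs       {zero}  {zero}  eq = refl
insertZero-injective (x ∷ xs) {suc p} {suc q} eq = cong suc (insertZero-injective xs (∷-injectiveʳ eq))
insertZero-injective (x ∷ xs) {zero}  {suc q} ()
insertZero-injective (x ∷ xs) {suc p} {zero}  ()

-- Whether `zero` occurs in some child list tells `child` from `root`. Deleting it recovers the
-- smaller code, and where it occurs recovers the parent and the place.
children-injective : ∀ {n} (c d : Code n) → (∀ v → children c v ≡ children d v) → c ≡ d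
children-injective []       []       eq = refl
children-injective (root c) (root d) eq = cong root $ children-injective c d λ v →
  map-injective suc-injective (eq (suc v))
children-injective (root c) (child d u p) eq =
  contradiction (subst (zero ∈_) (sym (eq (suc u))) (zero∈child d u p)) (zero∉map-suc (children c u))
children-injective (child c u p) (root d) eq =
  contradiction (subst (zero ∈_) (eq (suc u)) (zero∈child c u p)) (zero∉map-suc (children d u))
children-injective (child c u p) (child d v q) eq
  with refl ← children-injective c d (λ w → trans (sym (dropZeros-child c u p w))
                (trans (cong dropZeros (eq (suc w))) (dropZeros-child d v q w)))
  -- The `zero` in the list of `u` can only be the newest vertex of the other code, so both codes
  -- give it the same parent.
  with new refl ← child-offspring d {v} {q} {i = suc u}
         (subst (zero ∈_) (eq (suc u)) (zero∈child c u p))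
  = cong (child c u) (insertZero-injective (children c u)
      (trans (sym (children-child-≡ c u p)) (trans (eq (suc u)) (children-child-≡ c u q))))

-- Rotations

_~_ : {A : Set} → Rel (List A) 0ℓ
_~_ = EqClosure _↻_

-- A single cut replaces a chain of elementary rotations, so that rotated lists can be analysed by
-- cases.
Rotation : {A : Set} → Rel (List A) 0ℓ
Rotation xs ys = ∃₂ λ as bs → xs ≡ as ++ bs × ys ≡ bs ++ as

rotation-fwd : ∀ {A : Set} {xs ys zs : List A} → Rotation xs ys → ys ↻ zs → Rotation xs zs
rotation-fwd (as , b ∷ bs , refl , refl) (rotate _ _) =
  as ∷ʳ b , bs , sym (++-assoc as [ b ] bs) , ++-assoc bs as [ b ]
-- The cut has gone all the way round and starts again after the first element.
rotation-fwd (a ∷ as , [] , refl , refl) (rotate _ _) =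
  [ a ] , as , cong (a ∷_) (++-identityʳ as) , refl

rotation-bwd : ∀ {A : Set} {xs ys zs : List A} → Rotation xs ys → zs ↻ ys → Rotation xs zs
rotation-bwd (as , bs , refl , eq) (rotate z zs) with initLast as
... | []       = zs , [ z ] , trans (sym (++-identityʳ bs)) (sym eq) , refl
... | as ∷ʳ′ a
  with refl , refl ← ∷ʳ-injective zs (bs ++ as) (trans eq (sym (++-assoc bs as [ a ]))) =
  as , a ∷ bs , ++-assoc as [ a ] bs , refl

~⇒rotation : ∀ {A : Set} {xs ys : List A} → xs ~ ys → Rotation xs ys
~⇒rotation {xs = xs} = go ([] , xs , refl , sym (++-identityʳ xs))
  where
  go : ∀ {ys zs} → Rotation xs ys → ys ~ zs → Rotation xs zs
  go r ε             = r
  go r (fwd s ◅ rest) = go (rotation-fwd r s) rest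
  go r (bwd s ◅ rest) = go (rotation-bwd r s) rest

++-rotate : ∀ {A : Set} (as bs : List A) → (as ++ bs) ~ (bs ++ as)
++-rotate []       bs = subst (bs ~_) (sym (++-identityʳ bs)) ε
++-rotate (a ∷ as) bs = fwd (rotate a (as ++ bs)) ◅
  subst₂ _~_ (sym (++-assoc as bs [ a ])) (++-assoc bs [ a ] as) (++-rotate as (bs ∷ʳ a))

~⇒↭ : ∀ {A : Set} {xs ys : List A} → xs ~ ys → xs ↭ ys
~⇒↭ e with as , bs , refl , refl ← ~⇒rotation e = ++-comm as bs

head∉tail : ∀ {A : Set} {x : A} {xs} → Unique (x ∷ xs) → x ∉ xs
head∉tail (x≢ ∷ _) = All¬⇒¬Any x≢

-- A nontrivial rotation keeping `v` in front would need a second occurrence of `v`. Hence cutting a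
-- cycle at a given element yields a well-defined list.
rotation-tail-unique : ∀ {A : Set} {v : A} {xs ys} →
  Unique (v ∷ xs) → (v ∷ xs) ~ (v ∷ ys) → xs ≡ ys
rotation-tail-unique {v = v} !vxs e with ~⇒rotation e
... | []     , bs     , eq   , eq′  = ∷-injectiveʳ (trans eq (sym (trans eq′ (++-identityʳ bs))))
... | a ∷ as , []     , eq   , eq′  = ∷-injectiveʳ (trans eq (trans (++-identityʳ (a ∷ as)) (sym eq′)))
... | a ∷ as , b ∷ bs , refl , refl = contradiction (∈-++⁺ʳ as (here refl)) (head∉tail !vxs)

rotate-to-front : ∀ {A : Set} {v : A} {xs} → v ∈ xs → ∃ λ ys → (v ∷ ys) ~ xs
rotate-to-front {v = v} v∈xs with as , bs , refl ← ∈-∃++ v∈xs = bs ++ as , ++-rotate (v ∷ bs) as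

-- Blocks of linked partitions

IsMin-unique : ∀ {n} {B : Subset n} {v w} → IsMin v B → IsMin w B → v ≡ w
IsMin-unique (v∈B , v≤) (w∈B , w≤) = Fin.≤-antisym (v≤ _ w∈B) (w≤ _ v∈B)

IsMin? : ∀ {n} (v : Fin n) B → Dec (IsMin v B)
IsMin? v B = (v Subset.∈? B) ×-dec all? (λ j → (j Subset.∈? B) →-dec (v Fin.≤? j))

nonempty⇒min : ∀ {n} {B : Subset n} → Nonempty B → ∃ λ v → IsMin v B
nonempty⇒min {B = inside  ∷ B} _ = zero , here , λ _ _ → ℕ.z≤n
nonempty⇒min {B = outside ∷ B} (suc x , there x∈B)
  with v , v∈B , v≤ ← nonempty⇒min (x , x∈B) =
  suc v , there v∈B , λ { (suc j) (there j∈B) → ℕ.s≤s (v≤ j j∈B) }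

1<∣B∣ : ∀ {n} {B : Subset n} {x y} → x Subset.∈ B → y Subset.∈ B → x ≢ y → 1 ℕ.< ∣ B ∣
1<∣B∣ {B = B} {x} {y} x∈B y∈B x≢y = subst (ℕ._< ∣ B ∣) (∣⁅x⁆∣≡1 x)
  (p⊂q⇒∣p∣<∣q∣
  ( (λ z∈ → subst (Subset._∈ B) (sym (x∈⁅y⁆⇒x≡y x z∈)) x∈B)
  , y , y∈B , λ y∈ → x≢y (sym (x∈⁅y⁆⇒x≡y x y∈))))

fromList : ∀ {n} → List (Fin n) → Subset n
fromList []       = Subset.⊥
fromList (x ∷ xs) = ⁅ x ⁆ ∪ fromList xs

∈-fromList⁺ : ∀ {n} {x : Fin n} xs → x ∈ xs → x Subset.∈ fromList xs
∈-fromList⁺ {x = x} (_ ∷ xs) (here refl) = x∈p∪q⁺ (inj₁ (x∈⁅x⁆ x))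
∈-fromList⁺         (_ ∷ xs) (there m)   = x∈p∪q⁺ (inj₂ (∈-fromList⁺ xs m))

∈-fromList⁻ : ∀ {n} {x : Fin n} xs → x Subset.∈ fromList xs → x ∈ xs
∈-fromList⁻ []       m = contradiction m ∉⊥
∈-fromList⁻ (y ∷ xs) m with x∈p∪q⁻ ⁅ y ⁆ (fromList xs) m
... | inj₁ m′ = here (x∈⁅y⁆⇒x≡y y m′)
... | inj₂ m′ = there (∈-fromList⁻ xs m′)

_≟ˢ_ : ∀ {n} (B C : Subset n) → Dec (B ≡ C)
_≟ˢ_ = Vec.≡-dec Bool._≟_

module _ {n} (L : LinkedPartition n) where
  open LinkedPartition L

  -- If the blocks were distinct, near disjointness would make the shared element the minimum of
  -- only one of them.
  min-determines-block : ∀ {B C v} → IsBlock B → IsBlock C → IsMin v B → IsMin v C → B ≡ C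
  min-determines-block {B} {C} {v} b c vB vC = decidable-stable (B ≟ˢ C) λ B≢C →
    [ (λ (_ , _ , ¬vC) → ¬vC vC) , (λ (_ , _ , ¬vB) → ¬vB vB) ]′
      (nearlyDisjoint B C b c B≢C v (x∈p∩q⁺ (proj₁ vB , proj₁ vC)))

  -- Distinct blocks share only elements that are the minimum of one of them. This is why a vertex
  -- has at most one parent.
  nonmin-determines-block : ∀ {B C v} → IsBlock B → IsBlock C →
    v Subset.∈ B → v Subset.∈ C → ¬ IsMin v B → ¬ IsMin v C → B ≡ C
  nonmin-determines-block {B} {C} {v} b c v∈B v∈C ¬vB ¬vC = decidable-stable (B ≟ˢ C) λ B≢C →
    [ ¬vB ∘ proj₁ , ¬vC ∘ proj₁ ]′ (nearlyDisjoint B C b c B≢C v (x∈p∩q⁺ (v∈B , v∈C)))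

-- Linked cycles as increasing forests

-- This specifies the child list of `v`: the cycle with minimum `v`, cut at `v`. Being a relation,
-- it applies both to lists found by search and to those of a given forest. The list is empty both
-- for a singleton block and for no block at all.
data CycleTail {n} (P : LinkedCycle n) (v : Fin n) : List (Fin n) → Set where
  fromBlock : ∀ {B xs} (b : LinkedCycle.IsBlock P B) → IsMin v B →
              (v ∷ xs) ~ listing (LinkedCycle.arrangement P B b) → CycleTail P v xs
  noBlock   : (∀ B → LinkedCycle.IsBlock P B → ¬ IsMin v B) → CycleTail P v []

module _ {n} (P : LinkedCycle n) where
  open LinkedCycle P

  cycleTail : ∀ v → ∃ (CycleTail P v)
  cycleTail v with anySubset? (λ B → Bool.T? (isBlock B) ×-dec IsMin? v B)
  ... | no none = [] , noBlock λ B b m → none (B , b , m)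
  ... | yes (B , b , m)
    with xs , e ← rotate-to-front (Equivalence.from (lists (arrangement B b) v) (proj₁ m)) =
    xs , fromBlock b m e

  childrenOf : Fin n → List (Fin n)
  childrenOf v = proj₁ (cycleTail v)

  module _ {v : Fin n} {xs : List (Fin n)} where
    cycleTail-cons-unique : ∀ {B} (b : IsBlock B) → (v ∷ xs) ~ listing (arrangement B b) →
      Unique (v ∷ xs)
    cycleTail-cons-unique {B} b e = Unique-resp-↭ (↭-sym (~⇒↭ e)) (unique (arrangement B b))

    ∈-cycleTail⁻ : CycleTail P v xs → ∀ {w} → w ∈ xs →
      ∃ λ B → IsBlock B × IsMin v B × w Subset.∈ B × w ≢ v
    ∈-cycleTail⁻ (fromBlock {B} b m e) {w} w∈xs =
      B , b , m , Equivalence.to (lists (arrangement B b) w) (∈-resp-↭ (~⇒↭ e) (there w∈xs)) ,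
      λ { refl → head∉tail (cycleTail-cons-unique b e) w∈xs }

    cycleTail-unique : CycleTail P v xs → Unique xs
    cycleTail-unique (noBlock _) = []
    cycleTail-unique (fromBlock b m e) with _ ∷ !xs ← cycleTail-cons-unique b e = !xs

    fromList-cycleTail : ∀ {B} (b : IsBlock B) → (v ∷ xs) ~ listing (arrangement B b) →
      fromList (v ∷ xs) ≡ B
    fromList-cycleTail {B} b e = ⊆-antisym
      (λ {w} m → Equivalence.to (lists (arrangement B b) w) (∈-resp-↭ (~⇒↭ e) (∈-fromList⁻ (v ∷ xs) m)))
      (λ {w} m → ∈-fromList⁺ (v ∷ xs)
        (∈-resp-↭ (↭-sym (~⇒↭ e)) (Equivalence.from (lists (arrangement B b) w) m)))

    block-cycleTail : CycleTail P v xs → ∀ {B} → IsBlock B → IsMin v B → fromList (v ∷ xs) ≡ B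
    block-cycleTail (noBlock none)     b vB = contradiction vB (none _ b)
    block-cycleTail (fromBlock c vC e) b vB =
      trans (fromList-cycleTail c e) (min-determines-block partition c b vC vB)

  -- A child of `v` is a non-minimal element of the block with minimum `v`. A vertex with two
  -- parents would thus be non-minimal in two blocks, which then coincide and have the same minimum.
  childrenOf-forest : Forest Fin._<_ childrenOf
  childrenOf-forest = record
    { ordered   = λ {v} m → let B , _ , vB , w∈B , w≢v = ∈-cycleTail⁻ (proj₂ (cycleTail v)) m in
                  ≤∧≢⇒< (proj₂ vB _ w∈B) (w≢v ∘ sym)
    ; distinct  = λ v → cycleTail-unique (proj₂ (cycleTail v))
    ; oneParent = oneParent′
    }
    where
    oneParent′ : ∀ {u v w} → w ∈ childrenOf u → w ∈ childrenOf v → u ≡ v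
    oneParent′ {u} {v} p q
      with B , b , uB , w∈B , w≢u ← ∈-cycleTail⁻ (proj₂ (cycleTail u)) p
      with C , c , vC , w∈C , w≢v ← ∈-cycleTail⁻ (proj₂ (cycleTail v)) q
      with refl ← nonmin-determines-block partition b c w∈B w∈C
                    (λ wB → w≢u (IsMin-unique wB uB)) (λ wC → w≢v (IsMin-unique wC vC))
      = IsMin-unique uB vC

-- Equal minima give the same block, so the two cut cycles are rotations of each other that both
-- start with `v`.
cycleTail-functional : ∀ {n} {P Q : LinkedCycle n} {v xs ys} → P ≈ Q →
  CycleTail P v xs → CycleTail Q v ys → xs ≡ ys
cycleTail-functional P≈Q (noBlock _) (noBlock _) = refl
cycleTail-functional P≈Q (noBlock none) (fromBlock {B} b m _) =
  contradiction m (none B (subst T (sym (sameBlocks P≈Q B)) b))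
cycleTail-functional P≈Q (fromBlock {B} b m _) (noBlock none) =
  contradiction m (none B (subst T (sameBlocks P≈Q B) b))
cycleTail-functional {P = P} P≈Q (fromBlock {B} b m e) (fromBlock {C} c m′ e′)
  with refl ← min-determines-block (LinkedCycle.partition P) b
                (subst T (sym (sameBlocks P≈Q C)) c) m m′ =
  rotation-tail-unique (cycleTail-cons-unique P b e)
    (transitive _↻_ e (transitive _↻_ (sameArrangements P≈Q B b c) (symmetric _↻_ e′)))

-- The linked cycle of a forest

module FromForest {n} {G : Fin n → List (Fin n)} (F : Forest Fin._<_ G) where

  -- A childless vertex forms a singleton block just when it has no parent: as a child it is already
  -- covered, and its singleton would not be nearly disjoint from the block of its parent.
  HeadsBlock : Fin n → Set
  HeadsBlock v = G v ≢ [] ⊎ (∀ u → v ∉ G u)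

  headsBlock? : ∀ v → Dec (HeadsBlock v)
  headsBlock? v = ¬? (List.≡-dec Fin._≟_ (G v) []) ⊎-dec all? (λ u → ¬? (v ∈? G u))

  block : Fin n → Subset n
  block v = fromList (v ∷ G v)

  Block : Subset n → Set
  Block B = ∃ λ v → HeadsBlock v × B ≡ block v

  block? : ∀ B → Dec (Block B)
  block? B = any? λ v → headsBlock? v ×-dec (B ≟ˢ block v)

  block-min : ∀ v → IsMin v (block v)
  block-min v = ∈-fromList⁺ (v ∷ G v) (here refl) , λ j j∈ → bound (∈-fromList⁻ (v ∷ G v) j∈)
    where
    bound : ∀ {j} → j ∈ (v ∷ G v) → v Fin.≤ j
    bound (here refl) = ℕ.≤-refl
    bound (there m)   = ℕ.<⇒≤ (ordered F m)

  parentHeads : ∀ {v w} → w ∈ G v → HeadsBlock v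
  parentHeads {v} m = inj₁ λ Gv≡[] → contradiction (subst (_ ∈_) Gv≡[] m) λ ()

  block-covers : ∀ i → ∃ λ B → Block B × i Subset.∈ B
  block-covers i with any? (λ v → i ∈? G v)
  ... | yes (v , m) = block v , (v , parentHeads m , refl) , ∈-fromList⁺ (v ∷ G v) (there m)
  ... | no orphan   =
    block i , (i , inj₂ (λ u m → orphan (u , m)) , refl) , ∈-fromList⁺ (i ∷ G i) (here refl)

  -- A head that is itself a child must have children, which makes its block large enough; its
  -- parent is smaller and lies in `block w`.
  child-head : ∀ {v w} → HeadsBlock v → v ∈ G w →
    IsMin v (block v) × 1 ℕ.< ∣ block v ∣ × ¬ IsMin v (block w)
  child-head {v} {w} h m = block-min v , big h , λ mw →
    Fin.<-irrefl (IsMin-unique (block-min w) mw) (ordered F m)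
    where
    big : HeadsBlock v → 1 ℕ.< ∣ block v ∣
    big (inj₂ orphan) = contradiction m (orphan w)
    big (inj₁ Gv≢[]) with G v in eq
    ... | []     = contradiction refl Gv≢[]
    ... | x ∷ xs = 1<∣B∣
      (∈-fromList⁺ (v ∷ x ∷ xs) (here refl)) (∈-fromList⁺ (v ∷ x ∷ xs) (there (here refl)))
      (Fin.<⇒≢ (ordered F (subst (x ∈_) (sym eq) (here refl))))

  -- A common element that is the head of both blocks, or a child in both, forces the blocks to be
  -- equal. In the mixed cases `child-head` applies.
  block-nearlyDisjoint : ∀ {E E′} → Block E → Block E′ → E ≢ E′ → NearlyDisjoint E E′
  block-nearlyDisjoint (v , hv , refl) (w , hw , refl) E≢E′ i i∈
    with i∈E , i∈E′ ← x∈p∩q⁻ (block v) (block w) i∈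
    with ∈-fromList⁻ (v ∷ G v) i∈E | ∈-fromList⁻ (w ∷ G w) i∈E′
  ... | here refl | here refl = contradiction refl E≢E′
  ... | here refl | there m   = inj₁ (child-head hv m)
  ... | there m   | here refl = inj₂ (child-head hw m)
  ... | there p   | there q   = contradiction (cong block (oneParent F p q)) E≢E′

  linkedCycle : LinkedCycle n
  linkedCycle = record
    { partition = record
      { isBlock        = λ B → ⌊ block? B ⌋
      ; nonempty       = λ B b → let v , _ , eq = toWitness b in
                         v , subst (v Subset.∈_) (sym eq) (proj₁ (block-min v))
      ; covers         = λ i → let B , b , i∈B = block-covers i in B , fromWitness b , i∈B
      ; nearlyDisjoint = λ E E′ b b′ → block-nearlyDisjoint (toWitness b) (toWitness b′)
      }
    ; arrangement = λ B b → let v , _ , eq = toWitness b in record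
      { listing = v ∷ G v
      ; unique  = ¬Any⇒All¬ _ (λ m → Fin.<-irrefl refl (ordered F m)) ∷ distinct F v
      ; lists   = λ i → mk⇔
          (λ m → subst (i Subset.∈_) (sym eq) (∈-fromList⁺ (v ∷ G v) m))
          (λ m → ∈-fromList⁻ (v ∷ G v) (subst (i Subset.∈_) eq m))
      }
    }

  cycleTail-linkedCycle : ∀ v → CycleTail linkedCycle v (G v)
  cycleTail-linkedCycle v with headsBlock? v
  ... | yes h = fromBlock b (block-min v)
      (subst (λ u → (v ∷ G v) ~ (u ∷ G u)) v≡u ε)
    where
    b : T ⌊ block? (block v) ⌋
    b = fromWitness (v , h , refl)
    -- The arrangement starts at the head `u` that the search in `block?` returns for `block v`; it
    -- equals `v` because both are the minimum of that block.
    u = proj₁ (toWitness b)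
    v≡u : v ≡ u
    v≡u = IsMin-unique (block-min v) (subst (IsMin u) (sym (proj₂ (proj₂ (toWitness b)))) (block-min u))
  ... | no ¬h = subst (CycleTail linkedCycle v) (sym Gv≡[]) (noBlock none)
    where
    Gv≡[] : G v ≡ []
    Gv≡[] = decidable-stable (List.≡-dec Fin._≟_ (G v) []) (¬h ∘ inj₁)
    none : ∀ B → T ⌊ block? B ⌋ → ¬ IsMin v B
    none B b vB with u , h , refl ← toWitness {a? = block? B} b =
      ¬h (subst HeadsBlock (IsMin-unique (block-min u) vB) h)

open FromForest using (linkedCycle; cycleTail-linkedCycle)

-- Recovering a linked cycle from its forest

module _ {n} (P : LinkedCycle n) {G : Fin n → List (Fin n)} (F : Forest Fin._<_ G)
         (tails : ∀ v → CycleTail P v (G v)) where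
  open LinkedCycle P
  open FromForest F hiding (linkedCycle; cycleTail-linkedCycle)

  -- The minimum `v` of the block is its head. If `v` has no children the block is a singleton, and
  -- near disjointness then keeps `v` from being a non-minimal element of another block, so `v` has
  -- no parent.
  isBlock⇒block : ∀ {B} → IsBlock B → Block B
  isBlock⇒block {B} b with v , vB ← nonempty⇒min (nonempty B b) = v , heads , sym block≡
    where
    block≡ : block v ≡ B
    block≡ = block-cycleTail P (tails v) b vB
    heads : HeadsBlock v
    heads with List.≡-dec Fin._≟_ (G v) []
    ... | no ≢[]  = inj₁ ≢[]
    ... | yes ≡[] = inj₂ λ u m → notChild (∈-cycleTail⁻ P (tails u) m)
      where
      B≡⁅v⁆ : B ≡ ⁅ v ⁆
      B≡⁅v⁆ = trans (sym block≡)
                (trans (cong (λ xs → fromList (v ∷ xs)) ≡[]) (∪-identityʳ ⁅ v ⁆))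
      notChild : ∀ {u} → ¬ (∃ λ C → IsBlock C × IsMin u C × v Subset.∈ C × v ≢ u)
      notChild (C , c , uC , v∈C , v≢u)
        with nearlyDisjoint B C b c (λ { refl → v≢u (IsMin-unique vB uC) }) v (x∈p∩q⁺ (proj₁ vB , v∈C))
      ... | inj₁ (_ , 1<∣B∣ , _) = ℕ.<-irrefl (sym (trans (cong ∣_∣ B≡⁅v⁆) (∣⁅x⁆∣≡1 v))) 1<∣B∣
      ... | inj₂ (vC , _)        = v≢u (IsMin-unique vC uC)

  -- If `v` were the minimum of no block of `P`, its list would be empty and it would have no
  -- parent. But some block covers `v`, and `v` would be a child of the minimum of that block.
  block⇒isBlock : ∀ {B} → Block B → IsBlock B
  block⇒isBlock (v , h , refl) = go (tails v) h
    where
    go : ∀ {xs} → CycleTail P v xs → xs ≢ [] ⊎ (∀ u → v ∉ G u) →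
      IsBlock (fromList (v ∷ xs))
    go (fromBlock b _ e) _            = subst IsBlock (sym (fromList-cycleTail P b e)) b
    go (noBlock none) (inj₁ []≢[])    = contradiction refl []≢[]
    go (noBlock none) (inj₂ orphan)
      with C , c , v∈C ← covers v
      with u , uC ← nonempty⇒min (v , v∈C)
      with ∈-fromList⁻ (u ∷ G u)
             (subst (v Subset.∈_) (sym (block-cycleTail P (tails u) c uC)) v∈C)
    ... | here refl = contradiction uC (none C c)
    ... | there m   = contradiction m (orphan u)

  linkedCycle-cycleTails : linkedCycle F ≈ P
  linkedCycle-cycleTails = record
    { sameBlocks = λ B → Bool.⇔→≡ (mk⇔
        (Equivalence.to Bool.T-≡ ∘ block⇒isBlock ∘ toWitness {a? = block? B} ∘ Equivalence.from Bool.T-≡)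
        (Equivalence.to Bool.T-≡ ∘ fromWitness {a? = block? B} ∘ isBlock⇒block ∘ Equivalence.from Bool.T-≡))
    ; sameArrangements = λ B p q → same q (toWitness p)
    }
    where
    same : ∀ {B} (q : IsBlock B) ((v , _) : Block B) → (v ∷ G v) ~ listing (arrangement B q)
    same q (v , _ , refl) = go (tails v) refl
      where
      go : ∀ {xs} → CycleTail P v xs → xs ≡ G v → (v ∷ xs) ~ listing (arrangement _ q)
      go (noBlock none) _ = contradiction (block-min v) (none _ q)
      go (fromBlock b m e) _
        with refl ← min-determines-block partition b q m (block-min v)
        with refl ← Bool.T-irrelevant b q = e

-- Counting linked cycles

-- Translates between the two numberings of vertices, from the largest down and from the smallest
-- up.
reverseLabels : ∀ {n} → (Fin n → List (Fin n)) → Fin n → List (Fin n)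
reverseLabels G v = map Fin.opposite (G (Fin.opposite v))

reverseLabels-cong : ∀ {n} {G H : Fin n → List (Fin n)} → G ≗ H → reverseLabels G ≗ reverseLabels H
reverseLabels-cong G≗H v = cong (map Fin.opposite) (G≗H (Fin.opposite v))

reverseLabels-involutive : ∀ {n} (G : Fin n → List (Fin n)) → reverseLabels (reverseLabels G) ≗ G
reverseLabels-involutive G v = begin
  map Fin.opposite (map Fin.opposite (G (Fin.opposite (Fin.opposite v))))
    ≡⟨ List.map-∘ _ ⟨
  map (Fin.opposite ∘ Fin.opposite) (G (Fin.opposite (Fin.opposite v)))
    ≡⟨ List.map-cong opposite-involutive _ ⟩
  map id (G (Fin.opposite (Fin.opposite v)))
    ≡⟨ List.map-id _ ⟩
  G (Fin.opposite (Fin.opposite v))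
    ≡⟨ cong G (opposite-involutive v) ⟩
  G v ∎
  where open ≡-Reasoning

opposite-injective : ∀ {n} {i j : Fin n} → Fin.opposite i ≡ Fin.opposite j → i ≡ j
opposite-injective {i = i} {j} eq =
  trans (sym (opposite-involutive i)) (trans (cong Fin.opposite eq) (opposite-involutive j))

opposite-mono-< : ∀ {n} {i j : Fin n} → i Fin.< j → Fin.opposite j Fin.< Fin.opposite i
opposite-mono-< {n} {i} {j} i<j =
  subst₂ ℕ._<_ (sym (Fin.opposite-prop j)) (sym (Fin.opposite-prop i))
    (ℕ.∸-monoʳ-< (ℕ.s≤s i<j) (Fin.toℕ<n j))

reverseLabels-forest : ∀ {n} {_≺_ _≺′_ : Rel (Fin n) 0ℓ} {G} →
  (∀ {v w} → Fin.opposite v ≺ w → v ≺′ Fin.opposite w) →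
  Forest _≺_ G → Forest _≺′_ (reverseLabels G)
reverseLabels-forest {G = G} reverse F = record
  { ordered   = λ {v} m → ordered′ v (∈-map⁻ Fin.opposite m)
  ; distinct  = λ v → map⁺ opposite-injective (distinct F (Fin.opposite v))
  ; oneParent = λ p q → opposite-injective (oneParent F (∈-opposite⁻ p) (∈-opposite⁻ q))
  }
  where
  ordered′ : ∀ v {w} → (∃ λ x → x ∈ G (Fin.opposite v) × w ≡ Fin.opposite x) → _
  ordered′ v (x , m , refl) = reverse (ordered F m)
  ∈-opposite⁻ : ∀ {w xs} → w ∈ map Fin.opposite xs → Fin.opposite w ∈ xs
  ∈-opposite⁻ m with x , m′ , refl ← ∈-map⁻ Fin.opposite m = subst (_∈ _) (sym (opposite-involutive x)) m′

childrenOf-linkedCycle : ∀ {n} {G : Fin n → List (Fin n)} (F : Forest Fin._<_ G) →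
  childrenOf (linkedCycle F) ≗ G
childrenOf-linkedCycle F v = cycleTail-functional (Setoid.refl (LinkedCycles _) {linkedCycle F})
  (proj₂ (cycleTail (linkedCycle F) v)) (cycleTail-linkedCycle F v)

-- Child lists determine both sides: codes by `children-injective`, linked cycles up to equivalence
-- by `linkedCycle-cycleTails`. Both round trips therefore only need to preserve child lists.
linkedCycles↔code : ∀ n → Inverse (LinkedCycles n) (setoid (Code n))
linkedCycles↔code n = record
  { to        = toCode
  ; from      = fromCode
  ; to-cong   = toCode-cong
  ; from-cong = λ { {c} refl → LC.refl {fromCode c} }
  ; inverse   = (λ {c} {P} P≈ → trans (toCode-cong {P} {fromCode c} P≈) (toCode-fromCode c))
              , (λ { {P} refl → fromCode-toCode P })
  }
  where
  module LC = Setoid (LinkedCycles n)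
  open ≡-Reasoning

  reversedChildren : LinkedCycle n → Fin n → List (Fin n)
  reversedChildren P = reverseLabels (childrenOf P)

  code : ∀ P → ∃ λ (c : Code n) → children c ≗ reversedChildren P
  code P = children-surjective (reverseLabels-forest
    (λ {v} {w} lt → subst (Fin.opposite w Fin.<_) (opposite-involutive v) (opposite-mono-< lt))
    (childrenOf-forest P))

  toCode : LinkedCycle n → Code n
  toCode P = proj₁ (code P)

  reversed-forest : ∀ c → Forest Fin._<_ (reverseLabels (children c))
  reversed-forest c = reverseLabels-forest
    (λ {v} {w} lt → subst (Fin._< Fin.opposite w) (opposite-involutive v) (opposite-mono-< lt))
    (children-forest c)

  fromCode : Code n → LinkedCycle n
  fromCode c = linkedCycle (reversed-forest c)

  toCode-cong : ∀ {P Q} → P ≈ Q → toCode P ≡ toCode Q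
  toCode-cong {P} {Q} P≈Q = children-injective _ _ λ v → begin
    children (toCode P) v ≡⟨ proj₂ (code P) v ⟩
    reversedChildren P v  ≡⟨ reverseLabels-cong (λ u →
                               cycleTail-functional P≈Q (proj₂ (cycleTail P u)) (proj₂ (cycleTail Q u))) v ⟩
    reversedChildren Q v  ≡⟨ proj₂ (code Q) v ⟨
    children (toCode Q) v ∎

  toCode-fromCode : ∀ c → toCode (fromCode c) ≡ c
  toCode-fromCode c = children-injective _ _ λ v → begin
    children (toCode (fromCode c)) v             ≡⟨ proj₂ (code (fromCode c)) v ⟩
    reversedChildren (fromCode c) v              ≡⟨ reverseLabels-cong (childrenOf-linkedCycle (reversed-forest c)) v ⟩
    reverseLabels (reverseLabels (children c)) v ≡⟨ reverseLabels-involutive (children c) v ⟩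
    children c v                                 ∎

  fromCode-toCode : ∀ P → fromCode (toCode P) ≈ P
  fromCode-toCode P = linkedCycle-cycleTails P (reversed-forest (toCode P)) λ v →
    subst (CycleTail P v) (sym (childrenOf≗ v)) (proj₂ (cycleTail P v))
    where
    childrenOf≗ : reverseLabels (children (toCode P)) ≗ childrenOf P
    childrenOf≗ v = trans (reverseLabels-cong (proj₂ (code P)) v) (reverseLabels-involutive (childrenOf P) v)

theorem4p7 : Σ (ℕ → ℕ) λ lc →
    (∀ n → HasCardinality (LinkedCycles n) (lc n)) ×
    (lc 1 ≡ 1) ×
    (lc 2 ≡ 2) ×
    (∀ n → 3 ≤ n → lc n ≡ (2 * n ∸ 3) * lc (n ∸ 1) + lc (n ∸ 2))
theorem4p7 =
  count , (λ n → Compose.inverse (linkedCycles↔code n) (code↔Fin n)) , refl , refl , recurrence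
  where
  recurrence : ∀ n → 3 ≤ n → count n ≡ (2 * n ∸ 3) * count (n ∸ 1) + count (n ∸ 2)
  recurrence (suc zero)    (ℕ.s≤s ())
  recurrence (suc (suc m)) _ = trans (count-recurrence m)
    (cong (λ k → k * count (suc m) + count m) (sym coefficient))
    where
    expand : ∀ m → 2 * (2 + m) ≡ 2 * m + 1 + 3
    expand = solve-∀
    coefficient : 2 * (2 + m) ∸ 3 ≡ 2 * m + 1
    -- Splitting off the summand 3 first makes the truncated subtraction exact.
    coefficient = trans (cong (_∸ 3) (expand m)) (ℕ.m+n∸n≡m (2 * m + 1) 3)
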